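{- Let $P_{\mathrm{queen}}(t)=\sum_{n\ge 0}p_{\mathrm{queen},n}t^n$, where $p_{\mathrm{queen},n}$ is the number of Catalan queen paths from $(0,0)$ to $(n,n)$. Then, as formal power series, $$P_{\mathrm{queen}}(t)=\frac{(1-t)(1+t-4t^2)-(1-t)^2\sqrt{1-12t+16t^2}}{2t(2-3t)^2}.$$
   Context: A lattice path with step set $S\subseteq\mathbb{N}\times\mathbb{N}$ from $(0,0)$ to $(n,m)$ is a finite (possibly empty) sequence of steps in $S$ summing to $(n,m)$; its nodes are $(0,0)$ and the points reached after each step. The path is Catalan if every node $(x,y)$ satisfies $x<y+1$, i.e. $x\le y$. A queen path is a path with step set $S=\{(a,0),(0,a):a>0\}\cup\{(a,a):a>0\}$, $a$ an integer. The square root is the power series square root with constant term $1$. -}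

module Defs where

import Algebra.Properties.CommutativeMonoid.Sum as Sum
open import Data.Integer.Base using (+_)
open import Data.Fin.Base using (toℕ)
import Data.Fin.Properties as Finₚ
open import Data.List.Base
  using (List; []; _∷_; length; foldr; filter; cartesianProduct; cartesianProductWith; upTo)
open import Data.List.Membership.Propositional using (_∈_)
open import Data.List.Membership.Propositional.Properties
open import Data.List.Relation.Unary.All as All using (All; []; _∷_)
open import Data.List.Relation.Unary.AllPairs using ([]; _∷_)
open import Data.List.Relation.Unary.Any using (here; there)
open import Data.List.Relation.Unary.Unique.Propositional using (Unique)
import Data.List.Relation.Unary.Unique.Propositional.Properties as Unique
open import Data.List.Properties using (∷-injective)
open import Data.List.Scans.Base using (scanl)
open import Data.Nat.Base as ℕ using (ℕ; zero; suc; _≤_; _<_; _>_; _∸_; z≤n; s≤s)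
import Data.Nat.Properties as ℕₚ
open import Data.Nat.Solver renaming (module +-*-Solver to ℕ-Solver)
open import Data.Product.Base using (∃; _×_; _,_; proj₁; proj₂; zip)
open import Data.Product.Properties using (≡-dec)
open import Data.Rational.Base as ℚ using (ℚ; 0ℚ; 1ℚ; ½)
import Data.Rational.Properties as ℚₚ
open import Data.Rational.Solver using (module +-*-Solver)
open import Data.Sum.Base using (inj₁; inj₂)
open import Level using (0ℓ; _⊔_)
open import Relation.Binary.PropositionalEquality
open import Relation.Nullary using (yes; no; ¬_)
import Relation.Nullary.Decidable as Dec
open import Relation.Nullary.Decidable using (_×-dec_)
open import Relation.Unary using (Pred; Decidable)

Point : Set
Point = ℕ × ℕ

StepSet : Set₁
StepSet = Pred Point 0ℓ

origin : Point
origin = 0 , 0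

infixl 6 _⊕_

_⊕_ : Point → Point → Point
_⊕_ = zip ℕ._+_ ℕ._+_

nodes : List Point → List Point
nodes = scanl _⊕_ origin

record IsPath (S : StepSet) (end : Point) (steps : List Point) : Set where
  constructor isPath
  field
    allSteps : All S steps
    sumsTo   : foldr _⊕_ origin steps ≡ end

IsCatalan : List Point → Set
IsCatalan steps = All (λ (x , y) → x < y ℕ.+ 1) (nodes steps)

data QueenStep : StepSet where
  horizontal : ∀ {a} → a > 0 → QueenStep (a , 0)
  vertical   : ∀ {a} → a > 0 → QueenStep (0 , a)
  diagonal   : ∀ {a} → a > 0 → QueenStep (a , a)

IsCatalanQueenPath : Point → Pred (List Point) 0ℓ
IsCatalanQueenPath end steps = IsPath QueenStep end steps × IsCatalan steps

-- A duplicate-free list of exactly the elements satisfying P; its length is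
-- the number of such elements and does not depend on the list chosen.
record Enumeration {a p} {A : Set a} (P : Pred A p) : Set (a ⊔ p) where
  field
    elements : List A
    unique   : Unique elements
    sound    : ∀ {x} → x ∈ elements → P x
    complete : ∀ {x} → P x → x ∈ elements

  cardinality : ℕ
  cardinality = length elements

queenStep? : Decidable QueenStep
queenStep? (zero  , zero)  = no λ { (horizontal ()) ; (vertical ()) ; (diagonal ()) }
queenStep? (suc _ , zero)  = yes (horizontal (s≤s z≤n))
queenStep? (zero  , suc _) = yes (vertical (s≤s z≤n))
queenStep? (suc a , suc b) with a ℕₚ.≟ b
... | yes refl = yes (diagonal (s≤s z≤n))
... | no  a≢b  = no λ { (diagonal _) → a≢b refl }

isCatalanQueenPath? : ∀ end → Decidable (IsCatalanQueenPath end)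
isCatalanQueenPath? end steps =
  Dec.map′ (λ (p , q) → isPath p q) (λ (isPath p q) → p , q)
    (All.all? queenStep? steps ×-dec ≡-dec ℕₚ._≟_ ℕₚ._≟_ (foldr _⊕_ origin steps) end)
  ×-dec All.all? (λ (x , y) → x ℕₚ.<? y ℕ.+ 1) (nodes steps)

-- Words of length at most k (not exactly k).
words : ∀ {a} {A : Set a} → List A → ℕ → List (List A)
words as zero    = [] ∷ []
words as (suc k) = [] ∷ cartesianProductWith _∷_ as (words as k)

words-unique : ∀ {a} {A : Set a} {as : List A} → Unique as → ∀ k → Unique (words as k)
words-unique u zero    = [] ∷ []
words-unique {as = as} u (suc k) =
  All.tabulate (λ w∈ []≡w → case∷ w∈ []≡w)
  ∷ Unique.cartesianProductWith⁺ _∷_ ∷-injective u (words-unique u k)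
  where
  case∷ : ∀ {w} → w ∈ cartesianProductWith _∷_ as (words as k) → ¬ ([] ≡ w)
  case∷ w∈ refl with () ← proj₂ (proj₂ (proj₂ (proj₂
    (∈-cartesianProductWith⁻ _∷_ as (words as k) w∈))))

words-complete : ∀ {a} {A : Set a} {as : List A} k {w} →
                 length w ≤ k → All (_∈ as) w → w ∈ words as k
words-complete zero    z≤n     []       = here refl
words-complete (suc k) z≤n     []       = here refl
words-complete (suc k) (s≤s l) (p ∷ ps) =
  there (∈-cartesianProductWith⁺ _∷_ p (words-complete k l ps))

box : Point → List Point
box (n , m) = cartesianProduct (upTo (suc n)) (upTo (suc m))

norm : Point → ℕ
norm (x , y) = x ℕ.+ y

norm-⊕ : ∀ p q → norm (p ⊕ q) ≡ norm p ℕ.+ norm q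
norm-⊕ (a , b) (c , d) = solve 4
  (λ a b c d → (a :+ c) :+ (b :+ d) := (a :+ b) :+ (c :+ d)) refl a b c d
  where open ℕ-Solver

queenStep-norm : ∀ {s} → QueenStep s → 1 ≤ norm s
queenStep-norm (horizontal a>0) = ℕₚ.m≤n⇒m≤n+o 0 a>0
queenStep-norm (vertical a>0)   = a>0
queenStep-norm (diagonal {a} a>0) = ℕₚ.m≤n⇒m≤n+o a a>0

length≤norm : ∀ {steps} → All QueenStep steps → length steps ≤ norm (foldr _⊕_ origin steps)
length≤norm [] = z≤n
length≤norm {s ∷ ss} (q ∷ qs) =
  subst (suc (length ss) ≤_) (sym (norm-⊕ s (foldr _⊕_ origin ss)))
    (ℕₚ.+-mono-≤ (queenStep-norm q) (length≤norm qs))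

∈-box : ∀ {n m x y} → x ≤ n → y ≤ m → (x , y) ∈ box (n , m)
∈-box x≤n y≤m = ∈-cartesianProduct⁺ (∈-upTo⁺ (s≤s x≤n)) (∈-upTo⁺ (s≤s y≤m))

steps∈box : ∀ steps {n m} → proj₁ (foldr _⊕_ origin steps) ≤ n →
            proj₂ (foldr _⊕_ origin steps) ≤ m → All (_∈ box (n , m)) steps
steps∈box []             _ _ = []
steps∈box ((x , y) ∷ ss) p q =
  ∈-box (ℕₚ.m+n≤o⇒m≤o x p) (ℕₚ.m+n≤o⇒m≤o y q)
  ∷ steps∈box ss (ℕₚ.m+n≤o⇒n≤o x p) (ℕₚ.m+n≤o⇒n≤o y q)

-- Queen steps have coordinate sum at least 1, so a path ending at end has at
-- most norm end steps; it is enough to search the words up to that length.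
catalanQueenPaths : ∀ end → Enumeration (IsCatalanQueenPath end)
catalanQueenPaths end = record
  { elements = filter (isCatalanQueenPath? end) candidates
  ; unique   = Unique.filter⁺ (isCatalanQueenPath? end)
                 (words-unique (Unique.cartesianProduct⁺ (Unique.upTo⁺ (suc (proj₁ end)))
                                                         (Unique.upTo⁺ (suc (proj₂ end))))
                               (norm end))
  ; sound    = λ w∈ → proj₂ (∈-filter⁻ (isCatalanQueenPath? end) {xs = candidates} w∈)
  ; complete = λ p → ∈-filter⁺ (isCatalanQueenPath? end) (candidate p) p
  }
  where
  candidates : List (List Point)
  candidates = words (box end) (norm end)

  candidate : ∀ {w} → IsCatalanQueenPath end w → w ∈ candidates
  candidate {w} (isPath qs refl , _) =
    words-complete (norm end) (length≤norm qs) (steps∈box w ℕₚ.≤-refl ℕₚ.≤-refl)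

p-queen : ℕ → ℕ
p-queen n = Enumeration.cardinality (catalanQueenPaths (n , n))

open Sum ℚₚ.+-0-commutativeMonoid public using (sum⁺-syntax; sum)

-- Formal power series over ℚ: f n is the coefficient of tⁿ.
Series : Set
Series = ℕ → ℚ

infix  4 _≈_
infixl 6 _+_ _-_
infixl 7 _*_ _•_
infixr 8 _^_
infix  9 #_

_≈_ : Series → Series → Set
f ≈ g = ∀ n → f n ≡ g n

fromℕ : ℕ → ℚ
fromℕ k = + k ℚ./ 1

#_ : ℕ → Series
(# k) zero    = fromℕ k
(# k) (suc _) = 0ℚ

t : Series
t zero          = 0ℚ
t (suc zero)    = 1ℚ
t (suc (suc _)) = 0ℚ

_+_ : Series → Series → Series
(f + g) n = f n ℚ.+ g n

_-_ : Series → Series → Series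
(f - g) n = f n ℚ.- g n

_•_ : ℚ → Series → Series
(c • f) n = c ℚ.* f n

_*_ : Series → Series → Series
(f * g) n = ∑[ i ≤ n ] (f (toℕ i) ℚ.* g (n ∸ toℕ i))

_^_ : Series → ℕ → Series
f ^ zero  = # 1
f ^ suc n = f * f ^ n

generatingFunction : (ℕ → ℕ) → Series
generatingFunction a n = fromℕ (a n)

P-queen : Series
P-queen = generatingFunction p-queen

-- If f has constant term 1, then √ f = 1 + u where u has constant term 0
-- and u = ½ (f - 1 - u²).  The k-th iterate of this fixed-point equation,
-- starting from 0, is correct up to degree k.
√-iterate : Series → ℕ → Series
√-iterate f zero    = # 0
√-iterate f (suc k) = ½ • (f - # 1 - √-iterate f k * √-iterate f k)

√-tail : Series → Series
√-tail f n = √-iterate f n n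

-- Only meaningful for series with constant term 1; see √-constant and √-square.
√ : Series → Series
√ f = # 1 + √-tail f

√-constant : ∀ f → √ f 0 ≡ 1ℚ
√-constant f = refl

*-congAt : ∀ {f f′ g g′ : Series} n →
           (∀ i → i ≤ n → f i ℚ.* g (n ∸ i) ≡ f′ i ℚ.* g′ (n ∸ i)) →
           (f * g) n ≡ (f′ * g′) n
*-congAt n eq = Sum.sum-cong-≗ ℚₚ.+-0-commutativeMonoid
  (λ i → eq (toℕ i) (ℕₚ.≤-pred (Finₚ.toℕ<n i)))

*-distribʳ-+ : ∀ h f g → (f + g) * h ≈ f * h + g * h
*-distribʳ-+ h f g zero = solve 3
  (λ f g h → (f :+ g) :* h :+ con 0ℚ := (f :* h :+ con 0ℚ) :+ (g :* h :+ con 0ℚ))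
  refl (f 0) (g 0) (h 0)
  where open +-*-Solver
*-distribʳ-+ h f g (suc n) = trans
  (cong ((f 0 ℚ.+ g 0) ℚ.* h (suc n) ℚ.+_) (*-distribʳ-+ h (λ i → f (suc i)) (λ i → g (suc i)) n))
  (solve 5 (λ f g h a b → (f :+ g) :* h :+ (a :+ b) := (f :* h :+ a) :+ (g :* h :+ b))
    refl (f 0) (g 0) (h (suc n)) _ _)
  where open +-*-Solver

*-distribˡ-+ : ∀ h f g → h * (f + g) ≈ h * f + h * g
*-distribˡ-+ h f g zero = solve 3
  (λ f g h → h :* (f :+ g) :+ con 0ℚ := (h :* f :+ con 0ℚ) :+ (h :* g :+ con 0ℚ))
  refl (f 0) (g 0) (h 0)
  where open +-*-Solver
*-distribˡ-+ h f g (suc n) = trans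
  (cong (h 0 ℚ.* (f (suc n) ℚ.+ g (suc n)) ℚ.+_) (*-distribˡ-+ (λ i → h (suc i)) f g n))
  (solve 5 (λ f g h a b → h :* (f :+ g) :+ (a :+ b) := (h :* f :+ a) :+ (h :* g :+ b))
    refl (f (suc n)) (g (suc n)) (h 0) _ _)
  where open +-*-Solver

zero-* : ∀ (z f : Series) → (∀ n → z n ≡ 0ℚ) → ∀ n → (z * f) n ≡ 0ℚ
zero-* z f z≡0 zero    rewrite z≡0 0 = trans (ℚₚ.+-identityʳ _) (ℚₚ.*-zeroˡ (f 0))
zero-* z f z≡0 (suc n) rewrite z≡0 0 = cong₂ ℚ._+_ (ℚₚ.*-zeroˡ (f (suc n)))
  (zero-* (λ i → z (suc i)) f (λ i → z≡0 (suc i)) n)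

*-identityˡ : ∀ f → # 1 * f ≈ f
*-identityˡ f zero    = trans (ℚₚ.+-identityʳ _) (ℚₚ.*-identityˡ (f 0))
*-identityˡ f (suc n) = trans
  (cong₂ ℚ._+_ (ℚₚ.*-identityˡ (f (suc n))) (zero-* (λ _ → 0ℚ) f (λ _ → refl) n))
  (ℚₚ.+-identityʳ _)

*-identityʳ : ∀ f → f * # 1 ≈ f
*-identityʳ f zero    = trans (ℚₚ.+-identityʳ _) (ℚₚ.*-identityʳ (f 0))
*-identityʳ f (suc n) = trans
  (cong₂ ℚ._+_ (ℚₚ.*-zeroʳ (f 0)) (*-identityʳ (λ i → f (suc i)) n))
  (ℚₚ.+-identityˡ _)

square-congAt : ∀ {u v : Series} k → u 0 ≡ 0ℚ → v 0 ≡ 0ℚ → (∀ i → i ≤ k → u i ≡ v i) →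
                ∀ i → i ≤ suc k → (u * u) i ≡ (v * v) i
square-congAt {u} {v} k u0 v0 u≡v i i≤1+k = *-congAt {u} {v} {u} {v} i term
  where
  term : ∀ j → j ≤ i → u j ℚ.* u (i ∸ j) ≡ v j ℚ.* v (i ∸ j)
  term zero _ rewrite u0 | v0 = trans (ℚₚ.*-zeroˡ (u i)) (sym (ℚₚ.*-zeroˡ (v i)))
  term (suc j) j<i with ℕₚ.m≤n⇒m<n∨m≡n j<i
  ... | inj₂ refl rewrite ℕₚ.n∸n≡0 j | u0 | v0 =
    trans (ℚₚ.*-zeroʳ (u (suc j))) (sym (ℚₚ.*-zeroʳ (v (suc j))))
  ... | inj₁ 1+j<i = cong₂ ℚ._*_
    (u≡v (suc j) (ℕₚ.≤-pred (ℕₚ.≤-trans 1+j<i i≤1+k)))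
    (u≡v (i ∸ suc j) (ℕₚ.≤-trans (ℕₚ.∸-mono i≤1+k (s≤s (z≤n {j}))) ℕₚ.≤-refl))

module _ (f : Series) (f0≡1 : f 0 ≡ 1ℚ) where

  √-iterate-0 : ∀ k → √-iterate f k 0 ≡ 0ℚ
  √-iterate-0 zero = refl
  √-iterate-0 (suc k) rewrite f0≡1 | √-iterate-0 k = refl

  √-iterate-stable : ∀ k i → i ≤ k → √-iterate f (suc k) i ≡ √-iterate f k i
  √-iterate-stable zero    zero z≤n = √-iterate-0 1
  √-iterate-stable (suc k) i    i≤  = cong (λ x → ½ ℚ.* (f i ℚ.- (# 1) i ℚ.- x))
    (square-congAt k (√-iterate-0 (suc k)) (√-iterate-0 k) (√-iterate-stable k) i i≤)

  √-iterate-tail : ∀ k i → i ≤ k → √-iterate f k i ≡ √-tail f i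
  √-iterate-tail zero    zero z≤n = refl
  √-iterate-tail (suc k) i i≤ with ℕₚ.m≤n⇒m<n∨m≡n i≤
  ... | inj₂ refl      = refl
  ... | inj₁ (s≤s i≤k) = trans (√-iterate-stable k i i≤k) (√-iterate-tail k i i≤k)

  √-tail-fixed : √-tail f ≈ ½ • (f - # 1 - √-tail f * √-tail f)
  √-tail-fixed n = trans (sym (√-iterate-stable n n ℕₚ.≤-refl))
    (cong (λ x → ½ ℚ.* (f n ℚ.- (# 1) n ℚ.- x))
      (square-congAt n (√-iterate-0 n) refl (√-iterate-tail n) n (ℕₚ.n≤1+n n)))

  √-square : √ f * √ f ≈ f
  √-square n = begin
    ((# 1 + u) * (# 1 + u)) n
      ≡⟨ *-distribʳ-+ (# 1 + u) (# 1) u n ⟩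
    (# 1 * (# 1 + u)) n ℚ.+ (u * (# 1 + u)) n
      ≡⟨ cong₂ ℚ._+_ (*-identityˡ (# 1 + u) n)
          (trans (*-distribˡ-+ u (# 1) u n) (cong (ℚ._+ (u * u) n) (*-identityʳ u n))) ⟩
    ((# 1) n ℚ.+ u n) ℚ.+ (u n ℚ.+ (u * u) n)
      ≡⟨ cong (λ x → ((# 1) n ℚ.+ x) ℚ.+ (x ℚ.+ (u * u) n)) (√-tail-fixed n) ⟩
    ((# 1) n ℚ.+ ½ ℚ.* d) ℚ.+ (½ ℚ.* d ℚ.+ (u * u) n)
      ≡⟨ solve 3 (λ o f w →
          (o :+ con ½ :* (f :- o :- w)) :+ (con ½ :* (f :- o :- w) :+ w) := f)
          refl ((# 1) n) (f n) ((u * u) n) ⟩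
    f n ∎
    where
    open ≡-Reasoning
    open +-*-Solver
    u = √-tail f
    d = f n ℚ.- (# 1) n ℚ.- (u * u) n

NonZero : Series → Set
NonZero f = ∃ λ n → f n ≢ 0ℚ

infixl 7 _/_
infix  4 _≃_

-- ℚ⟦t⟧ is an integral domain, so Fraction modulo _≃_ is its field of
-- fractions, the field of formal Laurent series.
record Fraction : Set where
  constructor mkFraction
  field
    numerator   : Series
    denominator : Series
    nonZero     : NonZero denominator

_/_ : (f g : Series) {{_ : NonZero g}} → Fraction
_/_ f g {{g≢0}} = mkFraction f g g≢0

_≃_ : Fraction → Fraction → Set
mkFraction f g _ ≃ mkFraction h k _ = f * k ≈ h * g

instance
  #1-nonZero : NonZero (# 1)
  #1-nonZero = 0 , λ ()

  -- The coefficient of t is 8.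
  2t⟨2-3t⟩²-nonZero : NonZero (# 2 * t * (# 2 - # 3 * t) ^ 2)
  2t⟨2-3t⟩²-nonZero = 1 , λ ()

⌜_⌝ : Series → Fraction
⌜ f ⌝ = f / # 1

{-# OPTIONS --safe #-}

-- Cut a Catalan queen path at a node of height d = y − x, and count the possible remainders
-- by their vertical length s.  Grouping remainders by the direction of the first step, and
-- peeling one unit off that step, gives linear recurrences in (d , s) that determine all the
-- counts.  They are solved by series that are geometric in d ≥ 1, with ratio (2 − 3t)μ, where μ is
-- the power series root of t(2 − 3t)²μ² − (1 + t − 4t²)μ + 1; the paths themselves (d = 0) are
-- counted by (1 − t)μ.  The discriminant of this quadratic is (1 − t)²(1 − 12t + 16t²).
module Submission where

open import Algebra.Bundles using (CommutativeRing)
import Algebra.Properties.Group as GroupProperties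
import Algebra.Solver.Ring as RingSolver
open import Algebra.Solver.Ring.AlmostCommutativeRing
  using (fromCommutativeRing; _-Raw-AlmostCommutative⟶_)
open import Data.Integer.Base as ℤ using (ℤ; +_; -[1+_])
import Data.Integer.Properties as ℤₚ
open import Data.List.Base using (List; []; _∷_; _++_; map; length; foldr)
open import Data.List.Membership.Propositional using (_∈_)
open import Data.List.Membership.Propositional.Properties
  using (∈-++⁺ˡ; ∈-++⁺ʳ; ∈-++⁻; ∈-map⁺; ∈-map⁻)
open import Data.List.Membership.Propositional.Properties.WithK using (unique∧set⇒bag)
open import Data.List.Properties using (length-++; length-map; ∷-injective)
open import Data.List.Relation.Binary.BagAndSetEquality using (∼bag⇒↭)
open import Data.List.Relation.Binary.Disjoint.Propositional using (Disjoint)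
open import Data.List.Relation.Binary.Permutation.Propositional.Properties using (↭-length)
open import Data.List.Relation.Unary.All using (All; []; _∷_)
open import Data.List.Relation.Unary.AllPairs using ([]; _∷_)
open import Data.List.Relation.Unary.Any using (here)
open import Data.List.Relation.Unary.Unique.Propositional using (Unique)
import Data.List.Relation.Unary.Unique.Propositional.Properties as Unique
open import Data.List.Scans.Base using (scanl)
open import Data.Maybe.Base using (Maybe; just; nothing)
open import Data.Nat.Base as ℕ using (ℕ; zero; suc; _≤_; _<_; z≤n; s≤s)
import Data.Nat.Properties as ℕₚ
open import Data.Nat.Solver renaming (module +-*-Solver to ℕ-Solver)
open import Data.Product.Base using (∃₂; _×_; _,_; proj₁; proj₂)
open import Data.Product.Properties using (,-injective)
open import Data.Rational.Base as ℚ using (ℚ; 0ℚ)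
import Data.Rational.Properties as ℚₚ
open import Data.Rational.Solver renaming (module +-*-Solver to ℚ-Solver)
open import Data.Rational.Unnormalised.Base as ℚᵘ using (mkℚᵘ; *≡*)
import Data.Rational.Unnormalised.Properties as ℚᵘₚ
open import Data.Sum.Base using (inj₁; inj₂)
open import Function.Base using (_∘_)
open import Function.Bundles using (mk⇔)
open import Relation.Binary.PropositionalEquality
import Relation.Binary.Reasoning.Setoid as SetoidReasoning
open import Relation.Nullary using (yes; no)
open import Relation.Unary using (Pred)

open import Defs

-- The ring of power series

-- _≈_ unfolds to a Π-type, from which f and g cannot be inferred; the record keeps them visible.
infix 4 _≋_
record _≋_ (f g : Series) : Set where
  constructor pointwise
  field at : f ≈ g
open _≋_

neg : Series → Series
neg f n = ℚ.- f n

tail : Series → Series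
tail f n = f (suc n)

≋-refl : ∀ {f} → f ≋ f
≋-refl = pointwise λ _ → refl

*-cong : ∀ {f f′ g g′} → f ≋ f′ → g ≋ g′ → f * g ≋ f′ * g′
*-cong {f} {f′} {g} {g′} p q = pointwise λ n →
  *-congAt {f} {f′} {g} {g′} n (λ i _ → cong₂ ℚ._*_ (at p i) (at q (n ℕ.∸ i)))

-- The convolution computes by splitting off its first term. Commutativity needs the last term split
-- off instead, since exchanging the factors reverses the order of the sum.
*-snoc : ∀ f g n → (f * g) (suc n) ≡ (f * tail g) n ℚ.+ f (suc n) ℚ.* g 0
*-snoc f g zero = solve 4
  (λ a b c d → a :* d :+ (b :* c :+ con 0ℚ) := (a :* d :+ con 0ℚ) :+ b :* c)
  refl (f 0) (f 1) (g 0) (g 1)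
  where open ℚ-Solver
*-snoc f g (suc n) = trans
  (cong (f 0 ℚ.* g (suc (suc n)) ℚ.+_) (*-snoc (tail f) g n))
  (sym (ℚₚ.+-assoc (f 0 ℚ.* g (suc (suc n))) ((tail f * tail g) n) (f (suc (suc n)) ℚ.* g 0)))

*-comm : ∀ f g → f * g ≈ g * f
*-comm f g zero    = cong (ℚ._+ 0ℚ) (ℚₚ.*-comm (f 0) (g 0))
*-comm f g (suc n) = begin
  f 0 ℚ.* g (suc n) ℚ.+ (tail f * g) n  ≡⟨ cong₂ ℚ._+_ (ℚₚ.*-comm (f 0) (g (suc n))) (*-comm (tail f) g n) ⟩
  g (suc n) ℚ.* f 0 ℚ.+ (g * tail f) n  ≡⟨ ℚₚ.+-comm (g (suc n) ℚ.* f 0) ((g * tail f) n) ⟩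
  (g * tail f) n ℚ.+ g (suc n) ℚ.* f 0  ≡⟨ *-snoc g f n ⟨
  (g * f) (suc n)                       ∎
  where open ≡-Reasoning

•-*-assoc : ∀ c f g → (c • f) * g ≈ c • (f * g)
•-*-assoc c f g zero = solve 3
  (λ c f g → c :* f :* g :+ con 0ℚ := c :* (f :* g :+ con 0ℚ)) refl c (f 0) (g 0)
  where open ℚ-Solver
•-*-assoc c f g (suc n) = trans
  (cong (c ℚ.* f 0 ℚ.* g (suc n) ℚ.+_) (•-*-assoc c (tail f) g n))
  (solve 4 (λ c f g r → c :* f :* g :+ c :* r := c :* (f :* g :+ r))
    refl c (f 0) (g (suc n)) ((tail f * g) n))
  where open ℚ-Solver

-- By computation `tail (f * g)` is `f 0 • tail g + tail f * g`, so distributivity reduces the claim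
-- to `tail f` in the previous degree.
*-assoc : ∀ f g h → (f * g) * h ≈ f * (g * h)
*-assoc f g h zero = solve 3
  (λ f g h → (f :* g :+ con 0ℚ) :* h :+ con 0ℚ := f :* (g :* h :+ con 0ℚ) :+ con 0ℚ)
  refl (f 0) (g 0) (h 0)
  where open ℚ-Solver
*-assoc f g h (suc n) = begin
  (f 0 ℚ.* g 0 ℚ.+ 0ℚ) ℚ.* h (suc n) ℚ.+ ((f 0 • tail g + tail f * g) * h) n
    ≡⟨ cong ((f 0 ℚ.* g 0 ℚ.+ 0ℚ) ℚ.* h (suc n) ℚ.+_)
         (trans (*-distribʳ-+ h (f 0 • tail g) (tail f * g) n)
           (cong₂ ℚ._+_ (•-*-assoc (f 0) (tail g) h n) (*-assoc (tail f) g h n))) ⟩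
  (f 0 ℚ.* g 0 ℚ.+ 0ℚ) ℚ.* h (suc n) ℚ.+ (f 0 ℚ.* (tail g * h) n ℚ.+ (tail f * (g * h)) n)
    ≡⟨ solve 5 (λ f g h r s → (f :* g :+ con 0ℚ) :* h :+ (f :* r :+ s) := f :* (g :* h :+ r) :+ s)
         refl (f 0) (g 0) (h (suc n)) ((tail g * h) n) ((tail f * (g * h)) n) ⟩
  f 0 ℚ.* (g 0 ℚ.* h (suc n) ℚ.+ (tail g * h) n) ℚ.+ (tail f * (g * h)) n ∎
  where
  open ≡-Reasoning
  open ℚ-Solver

#0≡0 : ∀ n → (# 0) n ≡ 0ℚ
#0≡0 zero    = refl
#0≡0 (suc _) = refl

series-ring : CommutativeRing _ _
series-ring = record
  { Carrier = Series ; _≈_ = _≋_ ; _+_ = _+_ ; _*_ = _*_ ; -_ = neg ; 0# = # 0 ; 1# = # 1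
  ; isCommutativeRing = record
    { isRing = record
      { +-isAbelianGroup = record
        { isGroup = record
          { isMonoid = record
            { isSemigroup = record
              { isMagma = record
                { isEquivalence = record
                  { refl  = pointwise λ _ → refl
                  ; sym   = λ p → pointwise λ n → sym (at p n)
                  ; trans = λ p q → pointwise λ n → trans (at p n) (at q n)
                  }
                ; ∙-cong = λ p q → pointwise λ n → cong₂ ℚ._+_ (at p n) (at q n)
                }
              ; assoc = λ f g h → pointwise λ n → ℚₚ.+-assoc (f n) (g n) (h n)
              }
            ; identity =
                (λ f → pointwise λ n → trans (cong (ℚ._+ f n) (#0≡0 n)) (ℚₚ.+-identityˡ (f n)))
              , (λ f → pointwise λ n → trans (cong (f n ℚ.+_) (#0≡0 n)) (ℚₚ.+-identityʳ (f n)))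
            }
          ; inverse =
              (λ f → pointwise λ n → trans (ℚₚ.+-inverseˡ (f n)) (sym (#0≡0 n)))
            , (λ f → pointwise λ n → trans (ℚₚ.+-inverseʳ (f n)) (sym (#0≡0 n)))
          ; ⁻¹-cong = λ p → pointwise λ n → cong ℚ.-_ (at p n)
          }
        ; comm = λ f g → pointwise λ n → ℚₚ.+-comm (f n) (g n)
        }
      ; *-cong     = *-cong
      ; *-assoc    = λ f g h → pointwise (*-assoc f g h)
      ; *-identity = (λ f → pointwise (*-identityˡ f)) , (λ f → pointwise (*-identityʳ f))
      ; distrib    = (λ h f g → pointwise (*-distribˡ-+ h f g))
                   , (λ h f g → pointwise (*-distribʳ-+ h f g))
      }
    ; *-comm = λ f g → pointwise (*-comm f g)
    }
  }

-- Integer constants and the ring solver for series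

fromℤ : ℤ → ℚ
fromℤ i = i ℚ./ 1

toℚᵘ-fromℤ : ∀ i → ℚ.toℚᵘ (fromℤ i) ℚᵘ.≃ mkℚᵘ i 0
toℚᵘ-fromℤ i = ℚₚ.toℚᵘ-fromℚᵘ (mkℚᵘ i 0)

-- `ℚ._/_` normalises by a gcd and does not reduce on variables. In the unnormalised rationals both
-- sides keep denominator 1, which leaves an identity of integers.
fromℤ-+ : ∀ i j → fromℤ (i ℤ.+ j) ≡ fromℤ i ℚ.+ fromℤ j
fromℤ-+ i j = ℚₚ.toℚᵘ-injective (begin
  ℚ.toℚᵘ (fromℤ (i ℤ.+ j))                     ≈⟨ toℚᵘ-fromℤ (i ℤ.+ j) ⟩
  mkℚᵘ (i ℤ.+ j) 0                             ≈⟨ *≡* (cong (ℤ._* + 1)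
                                                    (sym (cong₂ ℤ._+_ (ℤₚ.*-identityʳ i) (ℤₚ.*-identityʳ j)))) ⟩
  mkℚᵘ i 0 ℚᵘ.+ mkℚᵘ j 0                       ≈⟨ ℚᵘₚ.+-cong (toℚᵘ-fromℤ i) (toℚᵘ-fromℤ j) ⟨
  ℚ.toℚᵘ (fromℤ i) ℚᵘ.+ ℚ.toℚᵘ (fromℤ j)       ≈⟨ ℚₚ.toℚᵘ-homo-+ (fromℤ i) (fromℤ j) ⟨
  ℚ.toℚᵘ (fromℤ i ℚ.+ fromℤ j)                 ∎)
  where open ℚᵘₚ.≃-Reasoning

fromℤ-* : ∀ i j → fromℤ (i ℤ.* j) ≡ fromℤ i ℚ.* fromℤ j
fromℤ-* i j = ℚₚ.toℚᵘ-injective (begin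
  ℚ.toℚᵘ (fromℤ (i ℤ.* j))                     ≈⟨ toℚᵘ-fromℤ (i ℤ.* j) ⟩
  mkℚᵘ i 0 ℚᵘ.* mkℚᵘ j 0                       ≈⟨ ℚᵘₚ.*-cong (toℚᵘ-fromℤ i) (toℚᵘ-fromℤ j) ⟨
  ℚ.toℚᵘ (fromℤ i) ℚᵘ.* ℚ.toℚᵘ (fromℤ j)       ≈⟨ ℚₚ.toℚᵘ-homo-* (fromℤ i) (fromℤ j) ⟨
  ℚ.toℚᵘ (fromℤ i ℚ.* fromℤ j)                 ∎)
  where open ℚᵘₚ.≃-Reasoning

fromℤ-neg : ∀ i → fromℤ (ℤ.- i) ≡ ℚ.- fromℤ i
fromℤ-neg (+ zero)  = refl
fromℤ-neg (+ suc k) = refl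
fromℤ-neg -[1+ k ]  = sym (GroupProperties.⁻¹-involutive ℚₚ.+-0-group (fromℤ (+ suc k)))

-- Defined by cases so that the numerals # k are solver constants definitionally.
⟦_⟧ : ℤ → Series
⟦ + k ⟧      = # k
⟦ -[1+ k ] ⟧ = neg (# suc k)

⟦⟧-zero : ∀ i → ⟦ i ⟧ 0 ≡ fromℤ i
⟦⟧-zero (+ k)    = refl
⟦⟧-zero -[1+ k ] = refl

⟦⟧-suc : ∀ i n → ⟦ i ⟧ (suc n) ≡ 0ℚ
⟦⟧-suc (+ k)    n = refl
⟦⟧-suc -[1+ k ] n = refl

⟦⟧-homomorphism : ℤ.+-*-rawRing -Raw-AlmostCommutative⟶ fromCommutativeRing series-ring
⟦⟧-homomorphism = record
  { ⟦_⟧    = ⟦_⟧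
  ; +-homo = λ i j → pointwise λ
      { zero → trans (⟦⟧-zero (i ℤ.+ j)) (trans (fromℤ-+ i j)
          (sym (cong₂ ℚ._+_ (⟦⟧-zero i) (⟦⟧-zero j))))
      ; (suc n) → trans (⟦⟧-suc (i ℤ.+ j) n) (sym (cong₂ ℚ._+_ (⟦⟧-suc i n) (⟦⟧-suc j n))) }
  ; *-homo = λ i j → pointwise λ
      { zero → trans (⟦⟧-zero (i ℤ.* j)) (trans (fromℤ-* i j)
          (sym (trans (ℚₚ.+-identityʳ _) (cong₂ ℚ._*_ (⟦⟧-zero i) (⟦⟧-zero j)))))
      ; (suc n) → trans (⟦⟧-suc (i ℤ.* j) n) (sym (cong₂ ℚ._+_
          (trans (cong (⟦ i ⟧ 0 ℚ.*_) (⟦⟧-suc j n)) (ℚₚ.*-zeroʳ (⟦ i ⟧ 0)))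
          (zero-* (tail ⟦ i ⟧) ⟦ j ⟧ (⟦⟧-suc i) n))) }
  ; -‿homo = λ i → pointwise λ
      { zero → trans (⟦⟧-zero (ℤ.- i)) (trans (fromℤ-neg i) (cong ℚ.-_ (sym (⟦⟧-zero i))))
      ; (suc n) → trans (⟦⟧-suc (ℤ.- i) n) (cong ℚ.-_ (sym (⟦⟧-suc i n))) }
  ; 0-homo = pointwise λ _ → refl
  ; 1-homo = pointwise λ _ → refl
  }

⟦⟧≟ : ∀ i j → Maybe (⟦ i ⟧ ≋ ⟦ j ⟧)
⟦⟧≟ i j with i ℤₚ.≟ j
... | yes refl = just (pointwise λ _ → refl)
... | no _     = nothing

module SeriesSolver where
  open RingSolver ℤ.+-*-rawRing (fromCommutativeRing series-ring) ⟦⟧-homomorphism ⟦⟧≟ public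

  infix  9 #′_
  infixl 10 _²

  #′_ : ∀ {n} → ℕ → Polynomial n
  #′ k = con (+ k)

  -- Shaped so that it evaluates to what `f ^ 2` unfolds to, `f * (f * # 1)`; solved identities then
  -- match the series definitionally.
  _² : ∀ {n} → Polynomial n → Polynomial n
  p ² = p :* (p :* #′ 1)

module R = CommutativeRing series-ring

-- Multiplication by t and by constants

t-shift : ∀ f n → (t * f) (suc n) ≡ f n
t-shift f n = begin
  0ℚ ℚ.* f (suc n) ℚ.+ (tail t * f) n  ≡⟨ cong₂ ℚ._+_ (ℚₚ.*-zeroˡ (f (suc n))) (at (*-cong (pointwise tail-t) (≋-refl {f})) n) ⟩
  0ℚ ℚ.+ (# 1 * f) n                   ≡⟨ ℚₚ.+-identityˡ ((# 1 * f) n) ⟩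
  (# 1 * f) n                          ≡⟨ *-identityˡ f n ⟩
  f n                                  ∎
  where
  open ≡-Reasoning
  tail-t : tail t ≈ # 1
  tail-t zero    = refl
  tail-t (suc _) = refl

t-zero : ∀ f → (t * f) 0 ≡ 0ℚ
t-zero f = trans (ℚₚ.+-identityʳ (0ℚ ℚ.* f 0)) (ℚₚ.*-zeroˡ (f 0))

t-tail : ∀ f → f 0 ≡ 0ℚ → t * tail f ≋ f
t-tail f f0≡0 = pointwise λ
  { zero    → trans (t-zero (tail f)) (sym f0≡0)
  ; (suc n) → t-shift (tail f) n
  }

t-cancel : ∀ f → t * f ≋ # 0 → f ≋ # 0
t-cancel f tf≋0 = pointwise λ n → trans (sym (t-shift f n)) (trans (at tf≋0 (suc n)) (sym (#0≡0 n)))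

#-* : ∀ k f n → (# k * f) n ≡ fromℕ k ℚ.* f n
#-* k f zero    = ℚₚ.+-identityʳ (fromℕ k ℚ.* f 0)
#-* k f (suc n) = trans
  (cong (fromℕ k ℚ.* f (suc n) ℚ.+_) (zero-* (tail (# k)) f (λ _ → refl) n))
  (ℚₚ.+-identityʳ (fromℕ k ℚ.* f (suc n)))

scaleˡ : ∀ c {f g} → f ≋ g → c * f ≋ c * g
scaleˡ c f≋g = R.*-cong (≋-refl {c}) f≋g

scaleʳ : ∀ c {f g} → f ≋ g → f * c ≋ g * c
scaleʳ c f≋g = R.*-cong f≋g (≋-refl {c})

-- Serves to prove identities modulo known equations: the solver writes the discrepancy as a sum of
-- multiples of differences, and each such multiple is zero.
vanishing : ∀ c {f g} → f ≋ g → c * (f - g) ≋ # 0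
vanishing c {f} {g} f≋g = R.trans (scaleˡ c (R.trans (R.+-congʳ f≋g) (R.-‿inverseʳ g))) (R.zeroʳ c)

-- 1 / (4 − 6t).
ι : Series
ι zero    = + 1 ℚ./ 4
ι (suc n) = + 3 ℚ./ 2 ℚ.* ι n

ι-inverse : (# 4 - # 6 * t) * ι ≋ # 1
ι-inverse = R.trans
  (solve 2 (λ t ι → (#′ 4 :- #′ 6 :* t) :* ι := #′ 4 :* ι :- #′ 6 :* (t :* ι)) ≋-refl t ι)
  (pointwise λ
    { zero → refl
    -- In positive degree the ratio 3/2 of the geometric series `ι` makes 4 · 3/2 cancel against 6.
    ; (suc n) → trans
       (cong₂ ℚ._-_ (#-* 4 ι (suc n)) (trans (#-* 6 (t * ι) (suc n)) (cong (fromℕ 6 ℚ.*_) (t-shift ι n))))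
       (cancelled (ι n))
    })
  where
  open SeriesSolver
  cancelled : ∀ x → fromℕ 4 ℚ.* (+ 3 ℚ./ 2 ℚ.* x) ℚ.- fromℕ 6 ℚ.* x ≡ 0ℚ
  cancelled = ℚ-Solver.solve 1 (λ x →
      c (fromℕ 4) ⊗ (c (+ 3 ℚ./ 2) ⊗ x) ℚ-Solver.:- c (fromℕ 6) ⊗ x ℚ-Solver.:= c 0ℚ) refl
    where
    open ℚ-Solver using () renaming (con to c; _:*_ to _⊗_)

-- The power series root of the kernel

Δ : Series
Δ = # 1 - # 12 * t + # 16 * t ^ 2

-- Of the two signs in the quadratic formula, minus is the one whose constant term, 1 - 1, vanishes,
-- so that division by t gives a power series, `ν`.
numerator : Series
numerator = (# 1 + t - # 4 * t ^ 2) - (# 1 - t) * √ Δ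

ν : Series
ν = tail numerator

-- Since `ι` is 1/(2(2 - 3t)), this is `numerator` divided by 2t(2 - 3t)².
μ : Series
μ = # 2 * ι * ι * ν

μ-numerator : # 2 * t * (# 2 - # 3 * t) ^ 2 * μ ≋ numerator
μ-numerator = begin
  # 2 * t * (# 2 - # 3 * t) ^ 2 * μ
    ≈⟨ solve 3 (λ t ι ν → let p = (#′ 4 :- #′ 6 :* t) :* ι in
         #′ 2 :* t :* (#′ 2 :- #′ 3 :* t) ² :* (#′ 2 :* ι :* ι :* ν) := p :* (p :* (t :* ν))) ≋-refl t ι ν ⟩
  p * (p * (t * ν))
    ≈⟨ R.*-cong ι-inverse (scaleʳ (t * ν) ι-inverse) ⟩
  # 1 * (# 1 * (t * ν))
    ≈⟨ solve 1 (λ f → #′ 1 :* (#′ 1 :* f) := f) ≋-refl (t * ν) ⟩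
  t * ν
    ≈⟨ t-tail numerator refl ⟩
  numerator ∎
  where
  open SeriesSolver
  open SetoidReasoning R.setoid
  p = (# 4 - # 6 * t) * ι

residual : Series
residual = t * (# 2 - # 3 * t) ^ 2 * (μ * μ) - (# 1 + t - # 4 * t ^ 2) * μ + # 1

-- The residual first vanishes after multiplication by t(4 - 6t)² = 4t(2 - 3t)², the factor that
-- completes the square. Then t is cancelled by shifting coefficients and (4 - 6t)² by its inverse
-- `ι * ι`.
μ-quadratic : residual ≋ # 0
μ-quadratic = begin
  residual
    ≈⟨ solve 1 (λ r → r := #′ 1 :* (#′ 1 :* r)) ≋-refl residual ⟩
  # 1 * (# 1 * residual)
    ≈⟨ R.*-cong ι-inverse (scaleʳ residual ι-inverse) ⟨
  (q * ι) * ((q * ι) * residual)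
    ≈⟨ solve 3 (λ q ι r → (q :* ι) :* ((q :* ι) :* r) := ι :* ι :* (q :* q :* r)) ≋-refl q ι residual ⟩
  ι * ι * (q * q * residual)
    ≈⟨ scaleˡ (ι * ι) (t-cancel (q * q * residual) cleared) ⟩
  ι * ι * # 0
    ≈⟨ R.zeroʳ (ι * ι) ⟩
  # 0 ∎
  where
  open SeriesSolver
  open SetoidReasoning R.setoid
  q = # 4 - # 6 * t
  x = # 2 * t * (# 2 - # 3 * t) ^ 2 * μ
  N = # 1 + t - # 4 * t ^ 2
  -- Completing the square: x = N − (1 − t)√Δ by μ-numerator, so (x − N)² = (1 − t)²Δ.
  cleared : t * (q * q * residual) ≋ # 0
  cleared = begin
    t * (q * q * residual)
      -- The difference of squares (x - N)² - (y - N)² factors as (x + y - 2N)(x - y), and (y - N)²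
      -- is (1 - t)²s². Both summands on the right are thus multiples of known equations.
      ≈⟨ solve 3 (λ t s μ →
           let q = #′ 4 :- #′ 6 :* t
               N = #′ 1 :+ t :- #′ 4 :* t ²
               x = #′ 2 :* t :* (#′ 2 :- #′ 3 :* t) ² :* μ
               y = N :- (#′ 1 :- t) :* s
           in t :* (q :* q :* (t :* (#′ 2 :- #′ 3 :* t) ² :* (μ :* μ) :- N :* μ :+ #′ 1))
              := (x :+ y :- #′ 2 :* N) :* (x :- y)
                 :+ (#′ 1 :- t) ² :* (s :* s :- (#′ 1 :- #′ 12 :* t :+ #′ 16 :* t ²)))
           ≋-refl t (√ Δ) μ ⟩
    (x + numerator - # 2 * N) * (x - numerator) + (# 1 - t) ^ 2 * (√ Δ * √ Δ - Δ)
      ≈⟨ R.+-cong (vanishing (x + numerator - # 2 * N) μ-numerator)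
                  (vanishing ((# 1 - t) ^ 2) (pointwise (√-square Δ refl))) ⟩
    # 0 + # 0
      ≈⟨ R.+-identityˡ (# 0) ⟩
    # 0 ∎

-- Solution of the recurrences

-- Geometric ansatz for the number of suffixes starting at height d, and for those among them
-- whose first step has a given direction; it solves the recurrences below precisely because
-- growth is a root of the kernel t(2 − 3t)g² − (1 + t − 4t²)g + (2 − 3t).
growth : Series
growth = (# 2 - # 3 * t) * μ

fromHeight horizontalFirst verticalFirst diagonalFirst : ℕ → Series
fromHeight zero    = (# 1 - t) * μ
fromHeight (suc d) = (# 1 - t) * μ * (growth - # 1) * growth ^ d
horizontalFirst zero    = # 0
horizontalFirst (suc d) = (# 1 - t) * μ * growth ^ d
verticalFirst d = ((# 1 - # 2 * t) * μ - # 1) * growth ^ d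
diagonalFirst zero    = t * μ
diagonalFirst (suc d) = t * μ * (growth - # 1) * growth ^ d

emptyPath : ℕ → Series
emptyPath zero    = # 1
emptyPath (suc d) = # 0

-- Mirrors the classification of remainders by their first step. It is a polynomial identity valid
-- for every μ, because `growth` is (2 - 3t)μ.
fromHeight-split : ∀ d → fromHeight d ≋ emptyPath d + (horizontalFirst d + (verticalFirst d + diagonalFirst d))
fromHeight-split zero = solve 2 (λ t μ →
    (#′ 1 :- t) :* μ := #′ 1 :+ (#′ 0 :+ (((#′ 1 :- #′ 2 :* t) :* μ :- #′ 1) :* #′ 1 :+ t :* μ)))
  ≋-refl t μ
  where open SeriesSolver
fromHeight-split (suc d) = solve 3 (λ t μ r →
    let g = (#′ 2 :- #′ 3 :* t) :* μ in
    (#′ 1 :- t) :* μ :* (g :- #′ 1) :* r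
      := #′ 0 :+ ((#′ 1 :- t) :* μ :* r
           :+ (((#′ 1 :- #′ 2 :* t) :* μ :- #′ 1) :* (g :* r) :+ t :* μ :* (g :- #′ 1) :* r)))
  ≋-refl t μ (growth ^ d)
  where open SeriesSolver

-- A horizontal unit lowers d and leaves s alone, hence no factor t. The factor `growth - # 1` in
-- `fromHeight` makes the sum over heights telescope.
horizontalFirst-suc : ∀ d → horizontalFirst (suc d) ≋ fromHeight d + horizontalFirst d
horizontalFirst-suc zero = solve 1 (λ p → p :* #′ 1 := p :+ #′ 0) ≋-refl ((# 1 - t) * μ)
  where open SeriesSolver
horizontalFirst-suc (suc d) = solve 3 (λ p g r → p :* (g :* r) := p :* (g :- #′ 1) :* r :+ p :* r)
  ≋-refl ((# 1 - t) * μ) growth (growth ^ d)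
  where open SeriesSolver

-- A vertical unit raises d and uses one unit of s, hence the factor t. The two sides differ by
-- `growth ^ d * residual`, so this is the recurrence that requires the kernel equation.
verticalFirst-shift : ∀ d → verticalFirst d ≋ t * (fromHeight (suc d) + verticalFirst (suc d))
verticalFirst-shift d = begin
  verticalFirst d
    ≈⟨ solve 3 (λ t μ r →
         let g = (#′ 2 :- #′ 3 :* t) :* μ
             v = (#′ 1 :- #′ 2 :* t) :* μ :- #′ 1
         in v :* r := t :* ((#′ 1 :- t) :* μ :* (g :- #′ 1) :* r :+ v :* (g :* r))
              :- r :* (t :* (#′ 2 :- #′ 3 :* t) ² :* (μ :* μ) :- (#′ 1 :+ t :- #′ 4 :* t ²) :* μ :+ #′ 1))
       ≋-refl t μ (growth ^ d) ⟩
  t * (fromHeight (suc d) + verticalFirst (suc d)) - growth ^ d * residual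
    ≈⟨ R.+-cong (≋-refl {x}) (R.-‿cong (R.trans (scaleˡ (growth ^ d) μ-quadratic) (R.zeroʳ (growth ^ d)))) ⟩
  x - # 0
    ≈⟨ solve 1 (λ x → x :- #′ 0 := x) ≋-refl x ⟩
  x ∎
  where
  open SeriesSolver
  open SetoidReasoning R.setoid
  x = t * (fromHeight (suc d) + verticalFirst (suc d))

diagonalFirst-shift : ∀ d → diagonalFirst d ≋ t * (fromHeight d + diagonalFirst d)
diagonalFirst-shift zero = solve 2 (λ t μ → t :* μ := t :* ((#′ 1 :- t) :* μ :+ t :* μ)) ≋-refl t μ
  where open SeriesSolver
diagonalFirst-shift (suc d) = solve 4 (λ t μ h r →
    t :* μ :* h :* r := t :* ((#′ 1 :- t) :* μ :* h :* r :+ t :* μ :* h :* r))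
  ≋-refl t μ (growth - # 1) (growth ^ d)
  where open SeriesSolver

-- Remainders of Catalan queen paths

-- Duplicate-free lists with the same members are equal as bags, hence permutations of each other.
cardinality-unique : ∀ {a p} {A : Set a} {P : Pred A p} (e e′ : Enumeration P) →
                     Enumeration.cardinality e ≡ Enumeration.cardinality e′
cardinality-unique e e′ = ↭-length (∼bag⇒↭ (unique∧set⇒bag (unique e) (unique e′)
  (mk⇔ (complete e′ ∘ sound e) (complete e ∘ sound e′))))
  where open Enumeration

-- A path suffix starting at height y − x = d above the diagonal and ending on
-- the diagonal, with s units of vertical (hence d + s of horizontal) distance left.
data Suffix : ℕ → ℕ → List Point → Set where
  []         : Suffix 0 0 []
  horizontal : ∀ {d s w} a → Suffix d s w → Suffix (suc a ℕ.+ d) s ((suc a , 0) ∷ w)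
  vertical   : ∀ {d s w} a → Suffix (suc a ℕ.+ d) s w → Suffix d (suc a ℕ.+ s) ((0 , suc a) ∷ w)
  diagonal   : ∀ {d s w} a → Suffix d s w → Suffix d (suc a ℕ.+ s) ((suc a , suc a) ∷ w)

-- Extends the first step by `e`. The value at `[]` is a default: the lists this is mapped over hold
-- only nonempty paths.
lengthen : Point → List Point → List Point
lengthen e []      = []
lengthen e (p ∷ w) = (e ⊕ p) ∷ w

⊕-cancelˡ : ∀ e {p q} → e ⊕ p ≡ e ⊕ q → p ≡ q
⊕-cancelˡ (a , b) eq = let eq₁ , eq₂ = ,-injective eq in
  cong₂ _,_ (ℕₚ.+-cancelˡ-≡ a _ _ eq₁) (ℕₚ.+-cancelˡ-≡ b _ _ eq₂)

lengthen-injective : ∀ e {v w} → lengthen e v ≡ lengthen e w → v ≡ w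
lengthen-injective e {[]}    {[]}    _  = refl
lengthen-injective e {p ∷ v} {q ∷ w} eq = let eq₁ , eq₂ = ∷-injective eq in
  cong₂ _∷_ (⊕-cancelˡ e eq₁) eq₂

⊕-identityʳ : ∀ e → e ⊕ origin ≡ e
⊕-identityʳ (a , b) = cong₂ _,_ (ℕₚ.+-identityʳ a) (ℕₚ.+-identityʳ b)

-- Peeling one unit off the first step turns the sum over its length into a two-term recurrence.
startingWith : Point → (rest shorter : List (List Point)) → List (List Point)
startingWith e rest shorter = map (e ∷_) rest ++ map (lengthen e) shorter

startingWith-length : ∀ e rest shorter →
  length (startingWith e rest shorter) ≡ length rest ℕ.+ length shorter
startingWith-length e rest shorter = trans (length-++ (map (e ∷_) rest))
  (cong₂ ℕ._+_ (length-map (e ∷_) rest) (length-map (lengthen e) shorter))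

-- A path in both halves would have first step `e` and also `e ⊕ p`, which forces `p` to be the
-- origin.
startingWith-unique : ∀ e {rest shorter} → Unique rest → Unique shorter →
  (∀ {w} → w ∈ shorter → ∃₂ λ p v → w ≡ p ∷ v × p ≢ origin) → Unique (startingWith e rest shorter)
startingWith-unique e {rest} {shorter} ur us start = Unique.++⁺
  (Unique.map⁺ (proj₂ ∘ ∷-injective) ur) (Unique.map⁺ (lengthen-injective e) us) disjoint
  where
  disjoint : Disjoint (map (e ∷_) rest) (map (lengthen e) shorter)
  disjoint (∈r , ∈s) with ∈-map⁻ (e ∷_) ∈r | ∈-map⁻ (lengthen e) ∈s
  ... | _ , _ , refl | w , w∈ , eq with start w∈
  ... | p , v , refl , p≢0 = p≢0 (⊕-cancelˡ e
    (trans (sym (proj₁ (∷-injective eq))) (sym (⊕-identityʳ e))))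

-- The recursion is lexicographic in (s, d): vertical and diagonal units lower s, even though the
-- former raise d, while horizontal units keep s and lower d.
empties suffixes horizontals verticals diagonals : ℕ → ℕ → List (List Point)
empties zero zero = [] ∷ []
empties _    _    = []
suffixes d s = empties d s ++ (horizontals d s ++ (verticals d s ++ diagonals d s))
horizontals zero    s = []
horizontals (suc d) s = startingWith (1 , 0) (suffixes d s) (horizontals d s)
verticals d zero    = []
verticals d (suc s) = startingWith (0 , 1) (suffixes (suc d) s) (verticals (suc d) s)
diagonals d zero    = []
diagonals d (suc s) = startingWith (1 , 1) (suffixes d s) (diagonals d s)

-- Completeness, soundness and uniqueness of the lists

∈-horizontals : ∀ a {d s w} → w ∈ suffixes d s → (suc a , 0) ∷ w ∈ horizontals (suc a ℕ.+ d) s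
∈-horizontals zero    w∈ = ∈-++⁺ˡ (∈-map⁺ _ w∈)
∈-horizontals (suc a) w∈ = ∈-++⁺ʳ _ (∈-map⁺ (lengthen (1 , 0)) (∈-horizontals a w∈))

∈-verticals : ∀ a {d s w} → w ∈ suffixes (suc a ℕ.+ d) s → (0 , suc a) ∷ w ∈ verticals d (suc a ℕ.+ s)
∈-verticals zero    w∈ = ∈-++⁺ˡ (∈-map⁺ _ w∈)
∈-verticals (suc a) {d} {s} {w} w∈ = ∈-++⁺ʳ _ (∈-map⁺ (lengthen (0 , 1))
  -- The shortened step starts one unit higher; it lands at the same height, written
  -- `suc a + suc d`.
  (∈-verticals a (subst (λ k → w ∈ suffixes (suc k) s) (sym (ℕₚ.+-suc a d)) w∈)))

∈-diagonals : ∀ a {d s w} → w ∈ suffixes d s → (suc a , suc a) ∷ w ∈ diagonals d (suc a ℕ.+ s)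
∈-diagonals zero    w∈ = ∈-++⁺ˡ (∈-map⁺ _ w∈)
∈-diagonals (suc a) {d} {s} w∈ =
  ∈-++⁺ʳ (map ((1 , 1) ∷_) (suffixes d (suc a ℕ.+ s))) (∈-map⁺ (lengthen (1 , 1)) (∈-diagonals a w∈))

suffixes-complete : ∀ {d s w} → Suffix d s w → w ∈ suffixes d s
suffixes-complete [] = here refl
suffixes-complete {d} {s} (horizontal a p) =
  ∈-++⁺ʳ (empties d s) (∈-++⁺ˡ (∈-horizontals a (suffixes-complete p)))
suffixes-complete {d} {s} (vertical a p) =
  ∈-++⁺ʳ (empties d s) (∈-++⁺ʳ (horizontals d s) (∈-++⁺ˡ (∈-verticals a (suffixes-complete p))))
suffixes-complete {d} {s} (diagonal a p) =
  ∈-++⁺ʳ (empties d s) (∈-++⁺ʳ (horizontals d s) (∈-++⁺ʳ (verticals d s)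
    (∈-diagonals a (suffixes-complete p))))

-- Records the direction of the first step in the type, so that soundness yields a step that can be
-- lengthened and also separates the lists from one another.
data Horizontal : ℕ → ℕ → List Point → Set where
  along : ∀ {d s w} a → Suffix d s w → Horizontal (suc a ℕ.+ d) s ((suc a , 0) ∷ w)

data Vertical : ℕ → ℕ → List Point → Set where
  along : ∀ {d s w} a → Suffix (suc a ℕ.+ d) s w → Vertical d (suc a ℕ.+ s) ((0 , suc a) ∷ w)

data Diagonal : ℕ → ℕ → List Point → Set where
  along : ∀ {d s w} a → Suffix d s w → Diagonal d (suc a ℕ.+ s) ((suc a , suc a) ∷ w)

data Empty : ℕ → ℕ → List Point → Set where
  [] : Empty 0 0 []

empties-sound : ∀ d s {w} → w ∈ empties d s → Empty d s w
empties-sound zero zero (here refl) = []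

suffixes-sound    : ∀ d s {w} → w ∈ suffixes d s → Suffix d s w
horizontals-sound : ∀ d s {w} → w ∈ horizontals d s → Horizontal d s w
verticals-sound   : ∀ d s {w} → w ∈ verticals d s → Vertical d s w
diagonals-sound   : ∀ d s {w} → w ∈ diagonals d s → Diagonal d s w
suffixes-sound d s w∈ with ∈-++⁻ (empties d s) w∈
... | inj₁ e∈ with [] ← empties-sound d s e∈ = []
... | inj₂ w∈ with ∈-++⁻ (horizontals d s) w∈
...   | inj₁ h∈ with along a p ← horizontals-sound d s h∈ = horizontal a p
...   | inj₂ w∈ with ∈-++⁻ (verticals d s) w∈
...     | inj₁ v∈ with along a p ← verticals-sound d s v∈ = vertical a p
...     | inj₂ d∈ with along a p ← diagonals-sound d s d∈ = diagonal a p
horizontals-sound (suc d) s w∈ with ∈-++⁻ (map ((1 , 0) ∷_) (suffixes d s)) w∈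
... | inj₁ r∈ with _ , v∈ , refl ← ∈-map⁻ ((1 , 0) ∷_) r∈ = along 0 (suffixes-sound d s v∈)
... | inj₂ l∈ with _ , v∈ , refl ← ∈-map⁻ (lengthen (1 , 0)) l∈
              with along a p ← horizontals-sound d s v∈ = along (suc a) p
verticals-sound d (suc s) w∈ with ∈-++⁻ (map ((0 , 1) ∷_) (suffixes (suc d) s)) w∈
... | inj₁ r∈ with _ , v∈ , refl ← ∈-map⁻ ((0 , 1) ∷_) r∈ = along 0 (suffixes-sound (suc d) s v∈)
... | inj₂ l∈ with _ , v∈ , refl ← ∈-map⁻ (lengthen (0 , 1)) l∈
              with along {s = s′} {w} a p ← verticals-sound (suc d) s v∈ =
  along (suc a) (subst (λ k → Suffix (suc k) s′ w) (ℕₚ.+-suc a d) p)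
diagonals-sound d (suc s) w∈ with ∈-++⁻ (map ((1 , 1) ∷_) (suffixes d s)) w∈
... | inj₁ r∈ with _ , v∈ , refl ← ∈-map⁻ ((1 , 1) ∷_) r∈ = along 0 (suffixes-sound d s v∈)
... | inj₂ l∈ with _ , v∈ , refl ← ∈-map⁻ (lengthen (1 , 1)) l∈
              with along a p ← diagonals-sound d s v∈ = along (suc a) p

empties-unique : ∀ d s → Unique (empties d s)
empties-unique zero    zero    = [] ∷ []
empties-unique zero    (suc s) = []
empties-unique (suc d) s       = []

suffixes-unique    : ∀ d s → Unique (suffixes d s)
horizontals-unique : ∀ d s → Unique (horizontals d s)
verticals-unique   : ∀ d s → Unique (verticals d s)
diagonals-unique   : ∀ d s → Unique (diagonals d s)
suffixes-unique d s =
  Unique.++⁺ (empties-unique d s)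
    (Unique.++⁺ (horizontals-unique d s)
      (Unique.++⁺ (verticals-unique d s) (diagonals-unique d s) v#d)
      h#)
    e#
  where
  v#d : Disjoint (verticals d s) (diagonals d s)
  v#d (v∈ , d∈) with verticals-sound d s v∈
  ... | along _ _ with () ← diagonals-sound d s d∈
  h# : Disjoint (horizontals d s) (verticals d s ++ diagonals d s)
  h# (h∈ , r∈) with horizontals-sound d s h∈ | ∈-++⁻ (verticals d s) r∈
  ... | along _ _ | inj₁ v∈ with () ← verticals-sound d s v∈
  ... | along _ _ | inj₂ d∈ with () ← diagonals-sound d s d∈
  e# : Disjoint (empties d s) (horizontals d s ++ (verticals d s ++ diagonals d s))
  e# (e∈ , r∈) with empties-sound d s e∈ | ∈-++⁻ (horizontals d s) r∈
  -- At d = s = 0 the vertical and diagonal lists compute to `[]`, so no `inj₂` case remains.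
  ... | [] | inj₁ h∈ with () ← horizontals-sound d s h∈
horizontals-unique zero    s = []
horizontals-unique (suc d) s =
  startingWith-unique (1 , 0) (suffixes-unique d s) (horizontals-unique d s) start
  where
  start : ∀ {w} → w ∈ horizontals d s → ∃₂ λ p v → w ≡ p ∷ v × p ≢ origin
  start w∈ with along a _ ← horizontals-sound d s w∈ = _ , _ , refl , λ ()
verticals-unique d zero    = []
verticals-unique d (suc s) =
  startingWith-unique (0 , 1) (suffixes-unique (suc d) s) (verticals-unique (suc d) s) start
  where
  start : ∀ {w} → w ∈ verticals (suc d) s → ∃₂ λ p v → w ≡ p ∷ v × p ≢ origin
  start w∈ with along a _ ← verticals-sound (suc d) s w∈ = _ , _ , refl , λ ()
diagonals-unique d zero    = []
diagonals-unique d (suc s) =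
  startingWith-unique (1 , 1) (suffixes-unique d s) (diagonals-unique d s) start
  where
  start : ∀ {w} → w ∈ diagonals d s → ∃₂ λ p v → w ≡ p ∷ v × p ≢ origin
  start w∈ with along a _ ← diagonals-sound d s w∈ = _ , _ , refl , λ ()

-- Remainders and the Catalan condition

IsCatalanFrom : Point → List Point → Set
IsCatalanFrom p w = All (λ (x , y) → x < y ℕ.+ 1) (scanl _⊕_ p w)

≤⇒<+1 : ∀ {m n} → m ≤ n → m < n ℕ.+ 1
≤⇒<+1 {m} {n} m≤n = subst (m <_) (ℕₚ.+-comm 1 n) (s≤s m≤n)

<+1⇒≤ : ∀ {m n} → m < n ℕ.+ 1 → m ≤ n
<+1⇒≤ {m} {n} m<n+1 = ℕₚ.≤-pred (subst (m <_) (ℕₚ.+-comm n 1) m<n+1)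

-- The starting node is arbitrary so that the induction can follow the path. Only a horizontal step
-- lowers the height, so only there is the Catalan condition invoked.
toSuffix : ∀ {x y d s} w → y ≡ x ℕ.+ d → All QueenStep w →
           foldr _⊕_ origin w ≡ (d ℕ.+ s , s) → IsCatalanFrom (x , y) w → Suffix d s w
toSuffix {d = zero}  []      _    _ refl _ = []
toSuffix {d = suc _} []      _    _ ()   _
toSuffix {x} {d = d} {s} (_ ∷ w) refl (horizontal {suc a} _ ∷ steps) total (_ ∷ nodes@(c ∷ _))
  -- The node after the step gives x + suc a ≤ x + d, hence suc a ≤ d; `d′` is the height that
  -- remains.
  with d′ , refl ← ℕₚ.m≤n⇒∃[o]m+o≡n (ℕₚ.+-cancelˡ-≤ x (suc a) d
         (subst (x ℕ.+ suc a ≤_) (ℕₚ.+-identityʳ (x ℕ.+ d)) (<+1⇒≤ c)))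
  = horizontal a (toSuffix w
      (solve 3 (λ x a d → (x :+ (a :+ d)) :+ con 0 := (x :+ a) :+ d) refl x (suc a) d′)
      steps
      (cong₂ _,_
        (ℕₚ.+-cancelˡ-≡ (suc a) _ _
          (trans (proj₁ (,-injective total)) (ℕₚ.+-assoc (suc a) d′ s)))
        (proj₂ (,-injective total)))
      nodes)
  where open ℕ-Solver
toSuffix {x} {d = d} (_ ∷ w) refl (vertical {suc a} _ ∷ steps) total (_ ∷ nodes)
  -- The second coordinate of the total shows s as `suc a` plus the vertical length of `w`.
  with eq , refl ← ,-injective total
  = vertical a (toSuffix w
      (solve 3 (λ x a d → (x :+ d) :+ a := (x :+ con 0) :+ (a :+ d)) refl x (suc a) d)
      steps
      (cong₂ _,_ (trans eq
        (solve 3 (λ d a s → d :+ (a :+ s) := (a :+ d) :+ s) refl d (suc a) _)) refl)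
      nodes)
  where open ℕ-Solver
toSuffix {x} {d = d} (_ ∷ w) refl (diagonal {suc a} _ ∷ steps) total (_ ∷ nodes)
  with eq , refl ← ,-injective total
  = diagonal a (toSuffix w
      (solve 3 (λ x a d → (x :+ d) :+ a := (x :+ a) :+ d) refl x (suc a) d)
      steps
      (cong₂ _,_ (ℕₚ.+-cancelˡ-≡ (suc a) _ _ (trans eq
        (solve 3 (λ d a s → d :+ (a :+ s) := a :+ (d :+ s)) refl d (suc a) _))) refl)
      nodes)
  where open ℕ-Solver

suffix-steps : ∀ {d s w} → Suffix d s w → All QueenStep w
suffix-steps []               = []
suffix-steps (horizontal a p) = horizontal (s≤s z≤n) ∷ suffix-steps p
suffix-steps (vertical a p)   = vertical (s≤s z≤n) ∷ suffix-steps p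
suffix-steps (diagonal a p)   = diagonal (s≤s z≤n) ∷ suffix-steps p

suffix-total : ∀ {d s w} → Suffix d s w → foldr _⊕_ origin w ≡ (d ℕ.+ s , s)
suffix-total [] = refl
suffix-total (horizontal {d} {s} a p) = trans (cong ((suc a , 0) ⊕_) (suffix-total p))
  (cong (_, s) (sym (ℕₚ.+-assoc (suc a) d s)))
suffix-total (vertical {d} {s} a p) = trans (cong ((0 , suc a) ⊕_) (suffix-total p))
  (cong (_, suc a ℕ.+ s) (solve 3 (λ a d s → (a :+ d) :+ s := d :+ (a :+ s)) refl (suc a) d s))
  where open ℕ-Solver
suffix-total (diagonal {d} {s} a p) = trans (cong ((suc a , suc a) ⊕_) (suffix-total p))
  (cong (_, suc a ℕ.+ s) (solve 3 (λ a d s → a :+ (d :+ s) := d :+ (a :+ s)) refl (suc a) d s))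
  where open ℕ-Solver

-- Every node has y = x + d with d a natural number, so x ≤ y is automatic.
suffix-catalan : ∀ {x y d s w} → y ≡ x ℕ.+ d → Suffix d s w → IsCatalanFrom (x , y) w
suffix-catalan {x} {d = d} refl [] = ≤⇒<+1 (ℕₚ.m≤m+n x d) ∷ []
suffix-catalan {x} refl (horizontal {d} a p) = ≤⇒<+1 (ℕₚ.m≤m+n x _) ∷ suffix-catalan
  (solve 3 (λ x a d → (x :+ (a :+ d)) :+ con 0 := (x :+ a) :+ d) refl x (suc a) d) p
  where open ℕ-Solver
suffix-catalan {x} refl (vertical {d} a p) = ≤⇒<+1 (ℕₚ.m≤m+n x _) ∷ suffix-catalan
  (solve 3 (λ x a d → (x :+ d) :+ a := (x :+ con 0) :+ (a :+ d)) refl x (suc a) d) p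
  where open ℕ-Solver
suffix-catalan {x} refl (diagonal {d} a p) = ≤⇒<+1 (ℕₚ.m≤m+n x _) ∷ suffix-catalan
  (solve 3 (λ x a d → (x :+ d) :+ a := (x :+ a) :+ d) refl x (suc a) d) p
  where open ℕ-Solver

suffixes-enumerate : ∀ n → Enumeration (IsCatalanQueenPath (n , n))
suffixes-enumerate n = record
  { elements = suffixes 0 n
  ; unique   = suffixes-unique 0 n
  ; sound    = λ w∈ → let p = suffixes-sound 0 n w∈ in
      isPath (suffix-steps p) (suffix-total p) , suffix-catalan refl p
  ; complete = λ { {w} (isPath steps total , catalan) →
      suffixes-complete (toSuffix w refl steps total catalan) }
  }

p-queen-suffixes : ∀ n → p-queen n ≡ length (suffixes 0 n)
p-queen-suffixes n = cardinality-unique (catalanQueenPaths (n , n)) (suffixes-enumerate n)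

-- Counting

fromℕ-+ : ∀ m n → fromℕ (m ℕ.+ n) ≡ fromℕ m ℚ.+ fromℕ n
fromℕ-+ m n = fromℤ-+ (+ m) (+ n)

count-++ : (v w : List (List Point)) → fromℕ (length (v ++ w)) ≡ fromℕ (length v) ℚ.+ fromℕ (length w)
count-++ v w = trans (cong fromℕ (length-++ v)) (fromℕ-+ (length v) (length w))

count-startingWith : ∀ e rest shorter → fromℕ (length (startingWith e rest shorter)) ≡
                     fromℕ (length rest) ℚ.+ fromℕ (length shorter)
count-startingWith e rest shorter = trans (cong fromℕ (startingWith-length e rest shorter))
  (fromℕ-+ (length rest) (length shorter))

count-empties : ∀ d s → fromℕ (length (empties d s)) ≡ emptyPath d s
count-empties zero    zero    = refl
count-empties zero    (suc s) = refl
count-empties (suc d) s       = sym (#0≡0 s)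

-- Lists and series satisfy the same recurrences, and the induction is the lexicographic one on (s,
-- d) that defines the lists: extracting a coefficient past a factor t lowers s.
count-suffixes    : ∀ d s → fromℕ (length (suffixes d s)) ≡ fromHeight d s
count-horizontals : ∀ d s → fromℕ (length (horizontals d s)) ≡ horizontalFirst d s
count-verticals   : ∀ d s → fromℕ (length (verticals d s)) ≡ verticalFirst d s
count-diagonals   : ∀ d s → fromℕ (length (diagonals d s)) ≡ diagonalFirst d s
count-suffixes d s = begin
  fromℕ (length (empties d s ++ (horizontals d s ++ (verticals d s ++ diagonals d s))))
    ≡⟨ trans (count-++ (empties d s) _) (cong (fromℕ (length (empties d s)) ℚ.+_)
         (trans (count-++ (horizontals d s) _) (cong (fromℕ (length (horizontals d s)) ℚ.+_)
           (count-++ (verticals d s) (diagonals d s))))) ⟩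
  fromℕ (length (empties d s)) ℚ.+ (fromℕ (length (horizontals d s)) ℚ.+
    (fromℕ (length (verticals d s)) ℚ.+ fromℕ (length (diagonals d s))))
    ≡⟨ cong₂ ℚ._+_ (count-empties d s) (cong₂ ℚ._+_ (count-horizontals d s)
         (cong₂ ℚ._+_ (count-verticals d s) (count-diagonals d s))) ⟩
  (emptyPath d + (horizontalFirst d + (verticalFirst d + diagonalFirst d))) s
    ≡⟨ at (fromHeight-split d) s ⟨
  fromHeight d s ∎
  where open ≡-Reasoning
count-horizontals zero    s = sym (#0≡0 s)
count-horizontals (suc d) s = begin
  fromℕ (length (horizontals (suc d) s))
    ≡⟨ count-startingWith (1 , 0) (suffixes d s) (horizontals d s) ⟩
  fromℕ (length (suffixes d s)) ℚ.+ fromℕ (length (horizontals d s))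
    ≡⟨ cong₂ ℚ._+_ (count-suffixes d s) (count-horizontals d s) ⟩
  (fromHeight d + horizontalFirst d) s
    ≡⟨ at (horizontalFirst-suc d) s ⟨
  horizontalFirst (suc d) s ∎
  where open ≡-Reasoning
-- With s = 0 the list is empty, and the series has zero constant term because it is a multiple of
-- t.
count-verticals d zero = sym (trans (at (verticalFirst-shift d) 0)
  (t-zero (fromHeight (suc d) + verticalFirst (suc d))))
count-verticals d (suc s) = begin
  fromℕ (length (verticals d (suc s)))
    ≡⟨ count-startingWith (0 , 1) (suffixes (suc d) s) (verticals (suc d) s) ⟩
  fromℕ (length (suffixes (suc d) s)) ℚ.+ fromℕ (length (verticals (suc d) s))
    ≡⟨ cong₂ ℚ._+_ (count-suffixes (suc d) s) (count-verticals (suc d) s) ⟩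
  (fromHeight (suc d) + verticalFirst (suc d)) s
    ≡⟨ t-shift (fromHeight (suc d) + verticalFirst (suc d)) s ⟨
  (t * (fromHeight (suc d) + verticalFirst (suc d))) (suc s)
    ≡⟨ at (verticalFirst-shift d) (suc s) ⟨
  verticalFirst d (suc s) ∎
  where open ≡-Reasoning
count-diagonals d zero = sym (trans (at (diagonalFirst-shift d) 0)
  (t-zero (fromHeight d + diagonalFirst d)))
count-diagonals d (suc s) = begin
  fromℕ (length (diagonals d (suc s)))
    ≡⟨ count-startingWith (1 , 1) (suffixes d s) (diagonals d s) ⟩
  fromℕ (length (suffixes d s)) ℚ.+ fromℕ (length (diagonals d s))
    ≡⟨ cong₂ ℚ._+_ (count-suffixes d s) (count-diagonals d s) ⟩
  (fromHeight d + diagonalFirst d) s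
    ≡⟨ t-shift (fromHeight d + diagonalFirst d) s ⟨
  (t * (fromHeight d + diagonalFirst d)) (suc s)
    ≡⟨ at (diagonalFirst-shift d) (suc s) ⟨
  diagonalFirst d (suc s) ∎
  where open ≡-Reasoning

-- The generating function of Catalan queen paths

P-queen≋fromHeight : P-queen ≋ fromHeight 0
P-queen≋fromHeight = pointwise λ n → trans (cong fromℕ (p-queen-suffixes n)) (count-suffixes 0 n)

theorem3p3 : ⌜ P-queen ⌝ ≃
    ((# 1 - t) * (# 1 + t - # 4 * t ^ 2) - (# 1 - t) ^ 2 * √ (# 1 - # 12 * t + # 16 * t ^ 2))
    / (# 2 * t * (# 2 - # 3 * t) ^ 2)
theorem3p3 = at (begin
  P-queen * D
    ≈⟨ scaleʳ D P-queen≋fromHeight ⟩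
  (# 1 - t) * μ * D
    ≈⟨ solve 3 (λ t μ d → (#′ 1 :- t) :* μ :* d := (#′ 1 :- t) :* (d :* μ)) ≋-refl t μ D ⟩
  (# 1 - t) * (D * μ)
    ≈⟨ scaleˡ (# 1 - t) μ-numerator ⟩
  (# 1 - t) * numerator
    -- The trailing factor `# 1` is the denominator of `⌜ P-queen ⌝`, left by the
    -- cross-multiplication in `_≃_`.
    ≈⟨ solve 2 (λ t s → (#′ 1 :- t) :* (#′ 1 :+ t :- #′ 4 :* t ² :- (#′ 1 :- t) :* s)
         := ((#′ 1 :- t) :* (#′ 1 :+ t :- #′ 4 :* t ²) :- (#′ 1 :- t) ² :* s) :* #′ 1)
         ≋-refl t (√ Δ) ⟩
  ((# 1 - t) * (# 1 + t - # 4 * t ^ 2) - (# 1 - t) ^ 2 * √ Δ) * # 1 ∎)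
  where
  open SeriesSolver
  open SetoidReasoning R.setoid
  D = # 2 * t * (# 2 - # 3 * t) ^ 2
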